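{- Let $k$ be a positive integer. If $k\equiv 2\pmod 4$, then the Möbius ladder $M_k$ is not cordial.
   Context: Graphs are finite and may have multiple edges but not loops. A binary labeling of a graph $G$ is a function $f:V(G)\to\{0,1\}$. Two real numbers $x,y$ are roughly equal if $0\le |x-y|\le 1$. A binary labeling $f$ is friendly if $|f^{ -1}(0)|$ and $|f^{ -1}(1)|$ are roughly equal. A binary labeling $f$ induces an edge labeling $f_e:E(G)\to\{0,1\}$ by $f_e(uv)=f(u)+f(v)$ modulo 2. A friendly labeling $f$ of $G$ is cordial if $|f_e^{ -1}(0)|$ and $|f_e^{ -1}(1)|$ are roughly equal; a graph is cordial if it has a cordial labeling. The Möbius ladder $M_k$ consists of the cycle $C_{2k}$ together with $k$ additional edges joining the opposite pairs of vertices of the cycle. -}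

module Defs where

open import Data.Fin using (Fin; toℕ; inject≤; splitAt; _≟_)
open import Data.Fin.Patterns using (0F; 1F)
open import Data.Fin.Properties using (toℕ-fromℕ<)
open import Data.Fin.Subset using (Subset; ∣_∣)
open import Data.Nat
  using (ℕ; _+_; _*_; _≤_; _<_; ∣_-_∣; NonZero; NonTrivial;
         nonTrivial⇒nonZero; n>1⇒nonTrivial; nonTrivial⇒n>1; >-nonZero⁻¹)
open import Data.Nat.DivMod using (_/_; _%_; _mod_; m≡m%n+[m/n]*n; m%n<n)
open import Data.Nat.Divisibility using (divides; ∣⇒≤)
open import Data.Nat.Properties
  using (+-cancelˡ-≡; <⇒≤; <⇒≱; m<m+n; *-monoʳ-≤)
open import Data.Product using (_×_; _,_; proj₁; proj₂; ∃-syntax)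
open import Data.Sum using (inj₁; inj₂; [_,_]′)
open import Data.Vec using (tabulate)
open import Relation.Binary.PropositionalEquality
  using (_≡_; _≢_; sym; trans; cong)
open import Relation.Nullary using (does)

-- The edges are indexed, so distinct edges may be parallel.  The two ends
-- of an edge come as an ordered pair, but nothing below depends on the order.
record Graph : Set where
  field
    order    : ℕ
    size     : ℕ
    ends     : Fin size → Fin order × Fin order
    loopless : ∀ e → proj₁ (ends e) ≢ proj₂ (ends e)

  Vertex : Set
  Vertex = Fin order

  Edge : Set
  Edge = Fin size

open Graph public

-- Only cardinalities are ever compared, so natural numbers suffice.
RoughlyEqual : ℕ → ℕ → Set
RoughlyEqual x y = ∣ x - y ∣ ≤ 1

infix 9 _⁻¹[_]

_⁻¹[_] : ∀ {n m} → (Fin n → Fin m) → Fin m → Subset n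
f ⁻¹[ c ] = tabulate λ x → does (f x ≟ c)

BinaryLabeling : Graph → Set
BinaryLabeling G = Vertex G → Fin 2

edgeLabeling : ∀ G → BinaryLabeling G → Edge G → Fin 2
edgeLabeling G f e =
  let (u , v) = ends G e in (toℕ (f u) + toℕ (f v)) mod 2

IsFriendly : ∀ G → BinaryLabeling G → Set
IsFriendly G f = RoughlyEqual ∣ f ⁻¹[ 0F ] ∣ ∣ f ⁻¹[ 1F ] ∣

IsCordial : ∀ G → BinaryLabeling G → Set
IsCordial G f =
  IsFriendly G f × RoughlyEqual ∣ fₑ ⁻¹[ 0F ] ∣ ∣ fₑ ⁻¹[ 1F ] ∣
  where fₑ = edgeLabeling G f

Cordial : Graph → Set
Cordial G = ∃[ f ] IsCordial G f

rotate : ∀ n .{{_ : NonZero n}} → ℕ → Fin n → Fin n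
rotate n d i = (toℕ i + d) mod n

rotate-≢ : ∀ n .{{_ : NonZero n}} d .{{_ : NonZero d}} → d < n →
           ∀ i → i ≢ rotate n d i
rotate-≢ n d d<n i i≡ = <⇒≱ d<n (∣⇒≤ (divides q d≡qn))
  where
  q = (toℕ i + d) / n

  i≡rem : toℕ i ≡ (toℕ i + d) % n
  i≡rem = trans (cong toℕ i≡) (toℕ-fromℕ< (m%n<n (toℕ i + d) n))

  d≡qn : d ≡ q * n
  d≡qn = +-cancelˡ-≡ (toℕ i) d (q * n)
    (trans (m≡m%n+[m/n]*n (toℕ i + d) n) (cong (_+ q * n) (sym i≡rem)))

-- For n = 2 this is a pair of parallel edges.
cycle : ∀ n .{{_ : NonTrivial n}} → Graph
cycle n = record
  { order    = n
  ; size     = n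
  ; ends     = λ i → i , rotate n 1 i
  ; loopless = rotate-≢ n 1 (nonTrivial⇒n>1 n)
  }
  where instance _ = nonTrivial⇒nonZero n

-- The cycle on 2k vertices with the rungs {j , j + k}, for j < k, added.
-- For k = 1 it consists of three parallel edges.
möbiusLadder : ∀ k .{{_ : NonZero k}} → Graph
möbiusLadder k = record
  { order    = 2 * k
  ; size     = 2 * k + k
  ; ends     = λ e → [ ends C , rung ]′ (splitAt (2 * k) e)
  ; loopless = loopless′
  }
  where
  instance
    2k-nonTrivial : NonTrivial (2 * k)
    2k-nonTrivial = n>1⇒nonTrivial (*-monoʳ-≤ 2 (>-nonZero⁻¹ k))

    2k-nonZero : NonZero (2 * k)
    2k-nonZero = nonTrivial⇒nonZero (2 * k)

  C : Graph
  C = cycle (2 * k)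

  k<2k : k < 2 * k
  k<2k = m<m+n k (*-monoʳ-≤ 1 (>-nonZero⁻¹ k))

  vertex : Fin k → Fin (2 * k)
  vertex j = inject≤ j (<⇒≤ k<2k)

  rung : Fin k → Fin (2 * k) × Fin (2 * k)
  rung j = vertex j , rotate (2 * k) k (vertex j)

  loopless′ : ∀ e → let (u , v) = [ ends C , rung ]′ (splitAt (2 * k) e) in u ≢ v
  loopless′ e with splitAt (2 * k) e
  ... | inj₁ i = loopless C i
  ... | inj₂ j = rotate-≢ (2 * k) k k<2k (vertex j)

{-# OPTIONS --safe #-}
module Submission where

-- The Möbius ladder is cubic, so summing f(u) + f(v) over its edges uv gives
-- 3 |f⁻¹(1)|, which therefore has the parity of |fₑ⁻¹(1)|.  There are 2k
-- vertices and, k being even, an even number 3k of edges, so a cordial labeling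
-- splits both sets into equal halves.  Thus |f⁻¹(1)| = k is even, hence so is
-- |fₑ⁻¹(1)| = 3k/2, and 4 divides 3k, contrary to k ≡ 2 (mod 4).

open import Defs
open import Data.Fin using (Fin; zero; suc; toℕ; inject≤; splitAt)
open import Data.Fin.Patterns using (0F; 1F)
open import Data.Fin.Properties
  using (toℕ-injective; toℕ-fromℕ<; toℕ-inject≤; toℕ<n)
open import Data.Fin.Subset using (∣_∣)
open import Data.Nat
  using (ℕ; zero; suc; _+_; _*_; s≤s; NonZero)
open import Data.Nat.DivMod
  using (_%_; _/_; _mod_; m≡m%n+[m/n]*n; m<n⇒m%n≡m; n%n≡0)
open import Data.Nat.Divisibility
  using (_∣_; _∣?_; divides; ∣-refl; m∣m*n; n∣m*n; ∣n⇒∣m*n;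
         ∣m∣n⇒∣m+n; ∣m+n∣m⇒∣n; ∣n∣m%n⇒∣m; n∣m⇒m%n≡0; *-monoʳ-∣)
open import Data.Nat.Properties
  using (+-comm; +-assoc; +-suc; +-identityʳ; +-cancelˡ-≡; *-cancelˡ-≡; m≤m+n;
         m*n≢0; +-*-semiring)
open import Data.Nat.Tactic.RingSolver using (solve-∀)
open import Data.Product using (_×_; _,_; proj₁; proj₂)
open import Data.Sum as Sum using (_⊎_; inj₁; inj₂; [_,_]′)
open import Function using (_∘_; id)
open import Relation.Binary.PropositionalEquality
  using (_≡_; refl; sym; trans; cong; cong₂; subst; module ≡-Reasoning)
open import Relation.Nullary using (¬_; contradiction)
open import Relation.Nullary.Decidable using (from-no)

open import Algebra.Properties.Semiring.Sum +-*-semiring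
  using (sum; sum-cong-≗; ∑-distrib-+; *-distribʳ-sum)
open ≡-Reasoning

-- An even sum means equal parity, which excludes a difference of 1. Lowering both numbers by 1
-- preserves both hypotheses, so the recursion ends at a pair containing 0.
2∣m+n∧roughlyEqual⇒m≡n : ∀ m n → 2 ∣ m + n → RoughlyEqual m n → m ≡ n
2∣m+n∧roughlyEqual⇒m≡n 0 0 _ _ = refl
2∣m+n∧roughlyEqual⇒m≡n 0 1 2∣1 _ = contradiction 2∣1 (from-no (2 ∣? 1))
2∣m+n∧roughlyEqual⇒m≡n 1 0 2∣1 _ = contradiction 2∣1 (from-no (2 ∣? 1))
2∣m+n∧roughlyEqual⇒m≡n 0 (suc (suc _)) _ (s≤s ())
2∣m+n∧roughlyEqual⇒m≡n (suc (suc _)) 0 _ (s≤s ())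
2∣m+n∧roughlyEqual⇒m≡n (suc m) (suc n) 2∣ m≈n =
  cong suc (2∣m+n∧roughlyEqual⇒m≡n m n
    (∣m+n∣m⇒∣n (subst (2 ∣_) (cong suc (+-suc m n)) 2∣) ∣-refl) m≈n)

∣⁻¹[1]∣≡sum : ∀ {n} (f : Fin n → Fin 2) → ∣ f ⁻¹[ 1F ] ∣ ≡ sum (toℕ ∘ f)
∣⁻¹[1]∣≡sum {zero}  f = refl
∣⁻¹[1]∣≡sum {suc n} f with f 0F | ∣⁻¹[1]∣≡sum (f ∘ suc)
... | 0F | ih = ih
... | 1F | ih = cong suc ih

∣⁻¹[0]∣+∣⁻¹[1]∣≡n : ∀ {n} (f : Fin n → Fin 2) →
                    ∣ f ⁻¹[ 0F ] ∣ + ∣ f ⁻¹[ 1F ] ∣ ≡ n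
∣⁻¹[0]∣+∣⁻¹[1]∣≡n {zero}  f = refl
∣⁻¹[0]∣+∣⁻¹[1]∣≡n {suc n} f with f 0F | ∣⁻¹[0]∣+∣⁻¹[1]∣≡n (f ∘ suc)
... | 0F | ih = cong suc ih
... | 1F | ih = trans (+-suc _ _) (cong suc ih)

-- Serves both the vertex labels, with `n` equal to 2k, and the edge labels, with `n` equal to 3k.
2*∣⁻¹[1]∣≡n : ∀ {n} (f : Fin n → Fin 2) → 2 ∣ n →
              RoughlyEqual ∣ f ⁻¹[ 0F ] ∣ ∣ f ⁻¹[ 1F ] ∣ → 2 * ∣ f ⁻¹[ 1F ] ∣ ≡ n
2*∣⁻¹[1]∣≡n {n} f 2∣n f₀≈f₁ = begin
  f₁ + (f₁ + 0) ≡⟨ cong (f₁ +_) (+-identityʳ f₁) ⟩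
  f₁ + f₁       ≡⟨ cong (_+ f₁) f₀≡f₁ ⟨
  f₀ + f₁       ≡⟨ ∣⁻¹[0]∣+∣⁻¹[1]∣≡n f ⟩
  n             ∎
  where
  f₀ = ∣ f ⁻¹[ 0F ] ∣
  f₁ = ∣ f ⁻¹[ 1F ] ∣

  f₀≡f₁ : f₀ ≡ f₁
  f₀≡f₁ = 2∣m+n∧roughlyEqual⇒m≡n f₀ f₁
    (subst (2 ∣_) (sym (∣⁻¹[0]∣+∣⁻¹[1]∣≡n f)) 2∣n) f₀≈f₁

sum-splitAt : ∀ m {n} (h : Fin m ⊎ Fin n → ℕ) →
              sum (h ∘ splitAt m) ≡ sum (h ∘ inj₁) + sum (h ∘ inj₂)
sum-splitAt zero    h = refl
sum-splitAt (suc m) h = trans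
  (cong (h (inj₁ 0F) +_) (sum-splitAt m (h ∘ Sum.map suc id)))
  (sym (+-assoc (h (inj₁ 0F)) _ _))

-- The summand is a function on ℕ, so the second block is the same function with its argument
-- shifted by `m`. A rotation yields just such shifts.
sum-toℕ-+ : ∀ m n (g : ℕ → ℕ) →
            sum {m + n} (g ∘ toℕ) ≡ sum {m} (g ∘ toℕ) + sum {n} (λ i → g (toℕ i + m))
sum-toℕ-+ zero    n g = sum-cong-≗ {n} λ i → cong g (sym (+-identityʳ (toℕ i)))
sum-toℕ-+ (suc m) n g = trans
  (cong (g 0 +_) (trans (sum-toℕ-+ m n (g ∘ suc))
    (cong (sum {m} (g ∘ suc ∘ toℕ) +_)
      (sum-cong-≗ {n} λ i → cong g (sym (+-suc (toℕ i) m))))))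
  (sym (+-assoc (g 0) _ _))

-- Each vertex contributes its weight once per incident edge, so this is the degree-weighted sum of
-- `w`.
edgeSum : ∀ G → (Vertex G → ℕ) → ℕ
edgeSum G w = sum λ e → w (proj₁ (ends G e)) + w (proj₂ (ends G e))

-- The label of an edge is the remainder mod 2 of the sum of its end labels, so the edge sum and the
-- number of edges labeled 1 differ by an even number, twice the sum of the quotients.
2∣edgeSum⇒2∣∣edgeLabeling⁻¹[1]∣ : ∀ G (f : BinaryLabeling G) →
  2 ∣ edgeSum G (toℕ ∘ f) → 2 ∣ ∣ edgeLabeling G f ⁻¹[ 1F ] ∣
2∣edgeSum⇒2∣∣edgeLabeling⁻¹[1]∣ G f 2∣Σ =
  ∣m+n∣m⇒∣n (subst (2 ∣_) Σ≡ 2∣Σ) (n∣m*n (sum q))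
  where
  s q : Edge G → ℕ
  s e = toℕ (f (proj₁ (ends G e))) + toℕ (f (proj₂ (ends G e)))
  q e = s e / 2

  Σ≡ : edgeSum G (toℕ ∘ f) ≡ sum q * 2 + ∣ edgeLabeling G f ⁻¹[ 1F ] ∣
  Σ≡ = begin
    sum s
      ≡⟨ sum-cong-≗ (λ e → trans (m≡m%n+[m/n]*n (s e) 2)
           (trans (cong (_+ q e * 2) (sym (toℕ-fromℕ< _))) (+-comm _ (q e * 2)))) ⟩
    sum (λ e → q e * 2 + toℕ (edgeLabeling G f e))
      ≡⟨ ∑-distrib-+ (λ e → q e * 2) (toℕ ∘ edgeLabeling G f) ⟩
    sum (λ e → q e * 2) + sum (toℕ ∘ edgeLabeling G f)
      ≡⟨ cong₂ _+_ (*-distribʳ-sum 2 q) (∣⁻¹[1]∣≡sum (edgeLabeling G f)) ⟨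
    sum q * 2 + ∣ edgeLabeling G f ⁻¹[ 1F ] ∣ ∎

module _ (n : ℕ) .{{_ : NonZero n}} (w : Fin n → ℕ) where

  -- The extension of `w` to ℕ with period `n`: by definition `w (rotate n d i)` is
  -- `periodic (toℕ i + d)`.
  periodic : ℕ → ℕ
  periodic x = w (x mod n)

  periodic-toℕ : ∀ i → periodic (toℕ i) ≡ w i
  periodic-toℕ i = cong w (toℕ-injective
    (trans (toℕ-fromℕ< _) (m<n⇒m%n≡m (toℕ<n i))))

  periodic-n : periodic n ≡ periodic 0
  periodic-n = cong w (toℕ-injective (begin
    toℕ (n mod n) ≡⟨ toℕ-fromℕ< _ ⟩
    n % n         ≡⟨ n%n≡0 n ⟩
    0             ≡⟨ n∣m⇒m%n≡0 0 n (divides 0 refl) ⟨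
    0 % n         ≡⟨ toℕ-fromℕ< _ ⟨
    toℕ (0 mod n) ∎))

  sum-periodic : sum {n} (periodic ∘ toℕ) ≡ sum w
  sum-periodic = sum-cong-≗ periodic-toℕ

  -- Evaluate the sum of periodic over 0, …, n by splitting off either end.
  sum-rotate-1 : sum (w ∘ rotate n 1) ≡ sum w
  sum-rotate-1 = +-cancelˡ-≡ (periodic 0) _ _ (begin
    periodic 0 + sum (w ∘ rotate n 1)
      ≡⟨ cong (_+ sum (w ∘ rotate n 1)) (+-identityʳ (periodic 0)) ⟨
    (periodic 0 + 0) + sum (w ∘ rotate n 1)
      ≡⟨ sum-toℕ-+ 1 n periodic ⟨
    sum {1 + n} (periodic ∘ toℕ)
      ≡⟨ cong (λ l → sum {l} (periodic ∘ toℕ)) (+-comm 1 n) ⟩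
    sum {n + 1} (periodic ∘ toℕ)
      ≡⟨ sum-toℕ-+ n 1 periodic ⟩
    sum {n} (periodic ∘ toℕ) + (periodic n + 0)
      ≡⟨ cong₂ _+_ sum-periodic (trans (+-identityʳ (periodic n)) periodic-n) ⟩
    sum w + periodic 0
      ≡⟨ +-comm (sum w) (periodic 0) ⟩
    periodic 0 + sum w ∎)

-- The rungs form a perfect matching: j and j + k, for j < k, run once through all residues mod 2k.
sum-rungs : ∀ k .{{_ : NonZero (2 * k)}} (w : Fin (2 * k) → ℕ) →
  let v : Fin k → Fin (2 * k)
      v j = inject≤ j (m≤m+n k (k + 0))
  in sum (λ j → w (v j) + w (rotate (2 * k) k (v j))) ≡ sum w
sum-rungs k w = begin
  sum (λ j → w (v j) + w (rotate (2 * k) k (v j)))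
    ≡⟨ sum-cong-≗ (λ j → cong₂ _+_
         (trans (sym (periodic-toℕ (2 * k) w (v j))) (cong p (toℕ-inject≤ j _)))
         (cong (λ x → p (x + k)) (toℕ-inject≤ j _))) ⟩
  sum {k} (λ j → p (toℕ j) + p (toℕ j + k))
    ≡⟨ ∑-distrib-+ {k} (p ∘ toℕ) (λ j → p (toℕ j + k)) ⟩
  sum {k} (p ∘ toℕ) + sum {k} (λ j → p (toℕ j + k))
    ≡⟨ sum-toℕ-+ k k p ⟨
  sum {k + k} (p ∘ toℕ)
    ≡⟨ cong (λ l → sum {k + l} (p ∘ toℕ)) (+-identityʳ k) ⟨
  sum {2 * k} (p ∘ toℕ)
    ≡⟨ sum-periodic (2 * k) w ⟩
  sum w ∎
  where
  v : Fin k → Fin (2 * k)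
  v j = inject≤ j (m≤m+n k (k + 0))
  p = periodic (2 * k) w

-- The first ends of the cycle edges, their second ends and the rungs each cover every vertex
-- exactly once.
edgeSum-möbiusLadder : ∀ k .{{_ : NonZero k}} (w : Fin (2 * k) → ℕ) →
                       edgeSum (möbiusLadder k) w ≡ 3 * sum w
edgeSum-möbiusLadder k w = begin
  edgeSum (möbiusLadder k) w
    ≡⟨ sum-splitAt (2 * k) (endSum ∘ [ cycleEnds , rungEnds ]′) ⟩
  sum (endSum ∘ cycleEnds) + sum (endSum ∘ rungEnds)
    ≡⟨ cong₂ _+_ (∑-distrib-+ w (w ∘ rotate (2 * k) 1)) (sum-rungs k w) ⟩
  (sum w + sum (w ∘ rotate (2 * k) 1)) + sum w
    ≡⟨ cong (λ x → (sum w + x) + sum w) (sum-rotate-1 (2 * k) w) ⟩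
  (sum w + sum w) + sum w
    ≡⟨ x+x+x≡3x (sum w) ⟩
  3 * sum w ∎
  where
  instance _ = m*n≢0 2 k

  endSum : Fin (2 * k) × Fin (2 * k) → ℕ
  endSum (u , v) = w u + w v

  cycleEnds : Fin (2 * k) → Fin (2 * k) × Fin (2 * k)
  cycleEnds i = i , rotate (2 * k) 1 i

  rungEnds : Fin k → Fin (2 * k) × Fin (2 * k)
  rungEnds j = let v = inject≤ j (m≤m+n k (k + 0)) in v , rotate (2 * k) k v

  x+x+x≡3x : ∀ x → (x + x) + x ≡ 3 * x
  x+x+x≡3x = solve-∀

lemma1 : (k : ℕ) .{{_ : NonZero k}} → k % 4 ≡ 2 → ¬ Cordial (möbiusLadder k)
lemma1 k k%4≡2 (f , friendly , balanced) =
  contradiction (trans (sym k%4≡2) (n∣m⇒m%n≡0 k 4 4∣k)) λ ()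
  where
  fₑ = edgeLabeling (möbiusLadder k) f

  2∣k : 2 ∣ k
  2∣k = ∣n∣m%n⇒∣m (divides 2 refl) (subst (2 ∣_) (sym k%4≡2) ∣-refl)

  ∣f⁻¹[1]∣≡k : ∣ f ⁻¹[ 1F ] ∣ ≡ k
  ∣f⁻¹[1]∣≡k = *-cancelˡ-≡ _ k 2 (2*∣⁻¹[1]∣≡n f (m∣m*n k) friendly)

  2∣∣fₑ⁻¹[1]∣ : 2 ∣ ∣ fₑ ⁻¹[ 1F ] ∣
  2∣∣fₑ⁻¹[1]∣ = 2∣edgeSum⇒2∣∣edgeLabeling⁻¹[1]∣ (möbiusLadder k) f
    (subst (2 ∣_) (sym (edgeSum-möbiusLadder k (toℕ ∘ f)))
      (∣n⇒∣m*n 3 (subst (2 ∣_) (trans (sym ∣f⁻¹[1]∣≡k) (∣⁻¹[1]∣≡sum f)) 2∣k)))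

  4∣2k+k : 4 ∣ 2 * k + k
  4∣2k+k = subst (4 ∣_) (2*∣⁻¹[1]∣≡n fₑ (∣m∣n⇒∣m+n (m∣m*n k) 2∣k) balanced)
    (*-monoʳ-∣ 2 2∣∣fₑ⁻¹[1]∣)

  2x+x+x≡4x : ∀ x → (2 * x + x) + x ≡ 4 * x
  2x+x+x≡4x = solve-∀

  4∣k : 4 ∣ k
  -- As 3k + k = 4k, divisibility by 4 passes from 3k to k without an appeal to coprimality.
  4∣k = ∣m+n∣m⇒∣n (subst (4 ∣_) (sym (2x+x+x≡4x k)) (m∣m*n k)) 4∣2k+k
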